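{- Let $p$ be an odd prime, $q=p^e$, and let $k,l\ge 3$ be coprime to $p$ with $(k,l)$ hyperbolic, i.e. $1/k+1/l<1/2$. Let $\xi_\kappa,\xi_\lambda$ be primitive $2k$-th and $2l$-th roots of unity in $GF(q)$ or $GF(q^2)$, and let $\omega_\kappa=\xi_\kappa+\xi_\kappa^{ -1}$, $\omega_\lambda=\xi_\lambda+\xi_\lambda^{ -1}$. Consider the regular map of type $(k,l)$ given by the generating triple $(X,Y,Z)$ of matrices determined by $\xi_\kappa,\xi_\lambda$ described in the context, where $G=\langle X,Y,Z\rangle$ is isomorphic to $PSL(2,q)$ or $PGL(2,q)$. Then the map is Möbius regular if and only if $k$ is even and $\omega_\kappa^2+2\omega_\lambda^2=4$.
   Context: A regular map of type $(k,l)$ (vertex degree $k$, face length $l$) is identified with a group $G$ generated by three involutions $X,Y,Z$ such that $XY$, $YZ$, $ZX$ have orders exactly $2,k,l$ respectively; put $R=YZ$. A regular map is Möbius regular if any two distinct adjacent vertices are joined by exactly two edges and any open set supporting these edges contains a Möbius strip. By a known result (Li and Širáň), this is equivalent to the following group-theoretic condition, which may be taken as the definition: $k$ is even and $XR^{k/2}X=R^{k/2}Y$ in $G$. Matrices are regarded up to nonzero scalar multiples, i.e. as elements of $PGL(2,K)$ with $K$ an algebraic closure of $GF(p)$. For $k,l$ coprime to $p$, put $D=\omega_\kappa^2+\omega_\lambda^2-4$ (assumed nonzero), $\beta=-1/\sqrt{ -D}$, $\eta=(\xi_\kappa-\xi_\kappa^{ -1})^{ -1}$. The generating triple is $$X=\eta\beta\begin{pmatrix}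 D & D\omega_\lambda\xi_\kappa\\ -\omega_\lambda\xi_\kappa^{ -1} & -D\end{pmatrix},\quad Y=\beta\begin{pmatrix}0&\xi_\kappa D\\ \xi_\kappa^{ -1}&0\end{pmatrix},\quad Z=\beta\begin{pmatrix}0&D\\1&0\end{pmatrix}.$$ -}

module Defs where

open import Algebra.Bundles using (CommutativeRing; Group; Monoid)
import Algebra.Definitions.RawMonoid as RawMonoidDefs
import Algebra.Properties.Monoid.Mult as MonoidMult
import Algebra.Properties.Ring as RingProperties
import Algebra.Properties.Semiring.Mult.TCOptimised as SemiringMult
import Algebra.Solver.Ring as RingSolver
open import Algebra.Solver.Ring.AlmostCommutativeRing using (fromCommutativeRing; _-Raw-AlmostCommutative⟶_)
open import Algebra.Morphism.Structures using (IsRingMonomorphism; IsGroupIsomorphism)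
open import Data.Fin.Base using (Fin)
open import Data.Integer.Base as ℤ using (ℤ; +_; -[1+_]; _⊖_; _◃_)
import Data.Integer.Properties as ℤₚ
open import Data.List.Base using (List; []; _∷_; foldr)
open import Data.List.Relation.Unary.Any using (Any)
open import Data.Maybe.Base using (Maybe; just; nothing)
open import Data.Nat.Base as ℕ using (ℕ; zero; suc; NonZero; z≤n; s≤s)
open import Data.Nat.DivMod using (_/_)
open import Data.Nat.Divisibility using (_∣_)
import Data.Nat.Properties as ℕₚ
open import Data.Product.Base using (Σ; ∃; _×_; _,_; proj₁; proj₂)
open import Data.Rational.Base as ℚ using (½)
open import Data.Sign.Base as Sign using ()
open import Function.Bundles using (Inverse)
open import Level using (Level; _⊔_)
open import Relation.Binary.PropositionalEquality as ≡ using (_≡_)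
import Relation.Binary.Reasoning.Setoid as SetoidReasoning
open import Relation.Nullary using (¬_; yes; no)

private
  variable
    c ℓ c₁ ℓ₁ c₂ ℓ₂ : Level

Hyperbolic : (k l : ℕ) .{{_ : NonZero k}} .{{_ : NonZero l}} → Set
Hyperbolic k l = (+ 1 ℚ./ k) ℚ.+ (+ 1 ℚ./ l) ℚ.< ½

-- The order of x is exactly n; in the multiplicative monoid of a field this
-- says that x is a primitive n-th root of unity.

module _ (M : Monoid c ℓ) where
  open Monoid M
  open RawMonoidDefs rawMonoid using () renaming (_×_ to _times_)

  pow : Carrier → ℕ → Carrier
  pow x n = n times x

  HasOrder : Carrier → ℕ → Set ℓ
  HasOrder x n =
    0 ℕ.< n × pow x n ≈ ε × (∀ m → 0 ℕ.< m → m ℕ.< n → ¬ (pow x m ≈ ε))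

-- Fields in the classical sense: every element that is not 0# is invertible
-- (the library's Heyting fields carry an apartness relation instead).  The
-- inverse is total for readability; 0# ⁻¹ is left unconstrained.

record Field c ℓ : Set (Level.suc (c ⊔ ℓ)) where
  infix 9 _⁻¹
  field
    commutativeRing : CommutativeRing c ℓ
  open CommutativeRing commutativeRing public
  field
    _⁻¹         : Carrier → Carrier
    ⁻¹-cong     : ∀ {x y} → x ≈ y → x ⁻¹ ≈ y ⁻¹
    ⁻¹-inverseʳ : ∀ {x} → x ≉ 0# → x * x ⁻¹ ≈ 1#
    1≉0         : 1# ≉ 0#

IsGF : ℕ → Field c ℓ → Set (c ⊔ ℓ)
IsGF n F = Inverse (≡.setoid (Fin n)) (Field.setoid F)

record Embedding (F : Field c₁ ℓ₁) (K : Field c₂ ℓ₂) : Set (c₁ ⊔ ℓ₁ ⊔ c₂ ⊔ ℓ₂) where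
  private
    module F = Field F
    module K = Field K
  field
    ⟦_⟧                : F.Carrier → K.Carrier
    isRingMonomorphism : IsRingMonomorphism F.rawRing K.rawRing ⟦_⟧

  InImage : K.Carrier → Set (c₁ ⊔ ℓ₂)
  InImage y = ∃ λ x → ⟦ x ⟧ K.≈ y

  -- A coefficient list a₀ ∷ a₁ ∷ … stands for a₀ + a₁ X + …
  eval : List F.Carrier → K.Carrier → K.Carrier
  eval as x = foldr (λ a r → ⟦ a ⟧ K.+ x K.* r) K.0# as

  IsAlgebraic : Set (c₁ ⊔ ℓ₁ ⊔ c₂ ⊔ ℓ₂)
  IsAlgebraic = ∀ x → ∃ λ as → Any (F._≉ F.0#) as × eval as x K.≈ K.0#

open Embedding public using (InImage)

idEmbedding : (K : Field c ℓ) → Embedding K K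
idEmbedding K = record
  { ⟦_⟧ = λ x → x
  ; isRingMonomorphism = record
    { isRingHomomorphism = record
      { isSemiringHomomorphism = record
        { isNearSemiringHomomorphism = record
          { +-isMonoidHomomorphism = record
            { isMagmaHomomorphism = record
              { isRelHomomorphism = record { cong = λ e → e }
              ; homo = λ _ _ → refl }
            ; ε-homo = refl }
          ; *-homo = λ _ _ → refl }
        ; 1#-homo = refl }
      ; -‿homo = λ _ → refl }
    ; injective = λ e → e } }
  where open Field K

-- The polynomial a₀ ∷ as is nonconstant exactly when as has a nonzero entry.

IsAlgebraicallyClosed : Field c ℓ → Set (c ⊔ ℓ)
IsAlgebraicallyClosed K =
  ∀ a₀ as → Any (_≉ 0#) as → ∃ λ x → Embedding.eval (idEmbedding K) (a₀ ∷ as) x ≈ 0#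
  where open Field K

IsAlgebraicClosure : {F : Field c₁ ℓ₁} {K : Field c₂ ℓ₂} → Embedding F K → Set (c₁ ⊔ ℓ₁ ⊔ c₂ ⊔ ℓ₂)
IsAlgebraicClosure {K = K} ι = Embedding.IsAlgebraic ι × IsAlgebraicallyClosed K

_≅_ : Group c₁ ℓ₁ → Group c₂ ℓ₂ → Set (c₁ ⊔ ℓ₁ ⊔ c₂ ⊔ ℓ₂)
G ≅ H = ∃ λ f → IsGroupIsomorphism (Group.rawGroup G) (Group.rawGroup H) f

module _ (G : Group c ℓ) where
  open Group G

  data Generated (x y z : Carrier) : Carrier → Set (c ⊔ ℓ) where
    genX : Generated x y z x
    genY : Generated x y z y
    genZ : Generated x y z z
    genε : Generated x y z ε
    gen∙ : ∀ {g h} → Generated x y z g → Generated x y z h → Generated x y z (g ∙ h)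
    gen⁻¹ : ∀ {g} → Generated x y z g → Generated x y z (g ⁻¹)
    gen≈ : ∀ {g h} → g ≈ h → Generated x y z g → Generated x y z h

  generatedSubgroup : (x y z : Carrier) → Group (c ⊔ ℓ) ℓ
  generatedSubgroup x y z = record
    { Carrier = Σ Carrier (Generated x y z)
    ; _≈_     = λ g h → proj₁ g ≈ proj₁ h
    ; _∙_     = λ g h → proj₁ g ∙ proj₁ h , gen∙ (proj₂ g) (proj₂ h)
    ; ε       = ε , genε
    ; _⁻¹     = λ g → proj₁ g ⁻¹ , gen⁻¹ (proj₂ g)
    ; isGroup = record
      { isMonoid = record
        { isSemigroup = record
          { isMagma = record
            { isEquivalence = record { refl = refl ; sym = sym ; trans = trans }
            ; ∙-cong = ∙-cong }
          ; assoc = λ g h i → assoc (proj₁ g) (proj₁ h) (proj₁ i) }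
        ; identity = (λ g → identityˡ (proj₁ g)) , (λ g → identityʳ (proj₁ g)) }
      ; inverse = (λ g → inverseˡ (proj₁ g)) , (λ g → inverseʳ (proj₁ g))
      ; ⁻¹-cong = ⁻¹-cong } }

record RegularMap c ℓ (k l : ℕ) : Set (Level.suc (c ⊔ ℓ)) where
  field
    group : Group c ℓ
  open Group group public
  field
    X Y Z     : Carrier
    X-order   : HasOrder monoid X 2
    Y-order   : HasOrder monoid Y 2
    Z-order   : HasOrder monoid Z 2
    XY-order  : HasOrder monoid (X ∙ Y) 2
    YZ-order  : HasOrder monoid (Y ∙ Z) k
    ZX-order  : HasOrder monoid (Z ∙ X) l
    generated : ∀ g → Generated group X Y Z g

  R : Carrier
  R = Y ∙ Z

MöbiusRegular : ∀ {k l} → RegularMap c ℓ k l → Set ℓ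
MöbiusRegular {k = k} M =
  2 ∣ k × X ∙ pow monoid R (k / 2) ∙ X ≈ pow monoid R (k / 2) ∙ Y
  where open RegularMap M

module IntegerSolver (R : CommutativeRing c ℓ) where
  open CommutativeRing R
  open SemiringMult semiring using (×-homo-+; ×1-homo-*) renaming (_×_ to _times_; 1+× to times-suc)
  open RingProperties ring
  open SetoidReasoning setoid

  private
    fromℕ : ℕ → Carrier
    fromℕ n = n times 1#

    fromℤ : ℤ → Carrier
    fromℤ (+ n)    = fromℕ n
    fromℤ -[1+ n ] = - fromℕ (suc n)

    cancel : ∀ a x y → (a + x) - (a + y) ≈ x - y
    cancel a x y = begin
      (a + x) + - (a + y)      ≈⟨ +-cong (+-comm x a) (-‿+-comm a y) ⟨
      (x + a) + (- a + - y)    ≈⟨ +-assoc x a _ ⟩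
      x + (a + (- a + - y))    ≈⟨ +-congˡ (+-assoc a (- a) (- y)) ⟨
      x + ((a + - a) + - y)    ≈⟨ +-congˡ (+-congʳ (-‿inverseʳ a)) ⟩
      x + (0# + - y)           ≈⟨ +-congˡ (+-identityˡ _) ⟩
      x + - y                  ∎

    ⊖-homo : ∀ m n → fromℤ (m ⊖ n) ≈ fromℕ m - fromℕ n
    ⊖-homo m zero = sym (trans (+-congˡ -0#≈0#) (+-identityʳ _))
    ⊖-homo zero (suc n) = sym (+-identityˡ _)
    ⊖-homo (suc m) (suc n) = begin
      fromℤ (suc m ⊖ suc n)          ≡⟨ ≡.cong fromℤ (ℤₚ.[1+m]⊖[1+n]≡m⊖n m n) ⟩
      fromℤ (m ⊖ n)                  ≈⟨ ⊖-homo m n ⟩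
      fromℕ m - fromℕ n              ≈⟨ cancel 1# _ _ ⟨
      (1# + fromℕ m) - (1# + fromℕ n) ≈⟨ +-cong (times-suc m 1#) (-‿cong (times-suc n 1#)) ⟨
      fromℕ (suc m) - fromℕ (suc n)  ∎

    +-homo : ∀ i j → fromℤ (i ℤ.+ j) ≈ fromℤ i + fromℤ j
    +-homo (+ m)    (+ n)    = ×-homo-+ 1# m n
    +-homo (+ m)    -[1+ n ] = ⊖-homo m (suc n)
    +-homo -[1+ m ] (+ n)    = trans (⊖-homo n (suc m)) (+-comm _ _)
    +-homo -[1+ m ] -[1+ n ] = begin
      - fromℕ (suc (suc (m ℕ.+ n)))      ≡⟨ ≡.cong (λ i → - fromℕ (suc i)) (≡.sym (ℕₚ.+-suc m n)) ⟩
      - fromℕ (suc m ℕ.+ suc n)          ≈⟨ -‿cong (×-homo-+ 1# (suc m) (suc n)) ⟩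
      - (fromℕ (suc m) + fromℕ (suc n))  ≈⟨ -‿+-comm _ _ ⟨
      - fromℕ (suc m) + - fromℕ (suc n)  ∎

    -‿homo : ∀ i → fromℤ (ℤ.- i) ≈ - fromℤ i
    -‿homo (+ zero)  = sym -0#≈0#
    -‿homo (+ suc n) = refl
    -‿homo -[1+ n ]  = sym (-‿involutive _)

    +◃-homo : ∀ n → fromℤ (Sign.+ ◃ n) ≈ fromℕ n
    +◃-homo zero    = refl
    +◃-homo (suc n) = refl

    -◃-homo : ∀ n → fromℤ (Sign.- ◃ n) ≈ - fromℕ n
    -◃-homo zero    = sym -0#≈0#
    -◃-homo (suc n) = refl

    *-homo : ∀ i j → fromℤ (i ℤ.* j) ≈ fromℤ i * fromℤ j
    *-homo (+ m)    (+ n)    = trans (+◃-homo (m ℕ.* n)) (×1-homo-* m n)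
    *-homo (+ m)    -[1+ n ] = trans (-◃-homo (m ℕ.* suc n))
      (trans (-‿cong (×1-homo-* m (suc n))) (-‿distribʳ-* _ _))
    *-homo -[1+ m ] (+ n)    = trans (-◃-homo (suc m ℕ.* n))
      (trans (-‿cong (×1-homo-* (suc m) n)) (-‿distribˡ-* _ _))
    *-homo -[1+ m ] -[1+ n ] = trans (+◃-homo (suc m ℕ.* suc n))
      (trans (×1-homo-* (suc m) (suc n)) (sym (begin
        (- x) * (- y)   ≈⟨ -‿distribˡ-* x (- y) ⟨
        - (x * (- y))   ≈⟨ -‿cong (-‿distribʳ-* x y) ⟨
        - (- (x * y))   ≈⟨ -‿involutive _ ⟩
        x * y           ∎)))
      where
      x = fromℕ (suc m)
      y = fromℕ (suc n)

    homomorphism : ℤ.+-*-rawRing -Raw-AlmostCommutative⟶ fromCommutativeRing R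
    homomorphism = record
      { ⟦_⟧ = fromℤ ; +-homo = +-homo ; *-homo = *-homo ; -‿homo = -‿homo
      ; 0-homo = refl ; 1-homo = refl }

    _≟_ : ∀ i j → Maybe (fromℤ i ≈ fromℤ j)
    i ≟ j with i ℤₚ.≟ j
    ... | yes eq = just (reflexive (≡.cong fromℤ eq))
    ... | no  _  = nothing

  open RingSolver ℤ.+-*-rawRing (fromCommutativeRing R) homomorphism _≟_ public
    using (solve; con; _:=_; _:+_; _:*_; _:-_; :-_)

module FieldProperties (K : Field c ℓ) where
  open Field K
  open SetoidReasoning setoid
  open IntegerSolver commutativeRing

  *-cancelˡ-0 : ∀ {x y} → x ≉ 0# → x * y ≈ 0# → y ≈ 0#
  *-cancelˡ-0 {x} {y} x≉0 xy≈0 = begin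
    y               ≈⟨ *-identityˡ y ⟨
    1# * y          ≈⟨ *-congʳ (⁻¹-inverseʳ x≉0) ⟨
    (x * x ⁻¹) * y  ≈⟨ solve 3 (λ x x′ y → (x :* x′) :* y := x′ :* (x :* y)) refl x (x ⁻¹) y ⟩
    x ⁻¹ * (x * y)  ≈⟨ *-congˡ xy≈0 ⟩
    x ⁻¹ * 0#       ≈⟨ zeroʳ _ ⟩
    0#              ∎

  *-≉0 : ∀ {x y} → x ≉ 0# → y ≉ 0# → x * y ≉ 0#
  *-≉0 x≉0 y≉0 xy≈0 = y≉0 (*-cancelˡ-0 x≉0 xy≈0)

  factorˡ-≉0 : ∀ {x y} → x * y ≉ 0# → x ≉ 0#
  factorˡ-≉0 xy≉0 x≈0 = xy≉0 (trans (*-congʳ x≈0) (zeroˡ _))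

  factorʳ-≉0 : ∀ {x y} → x * y ≉ 0# → y ≉ 0#
  factorʳ-≉0 xy≉0 y≈0 = xy≉0 (trans (*-congˡ y≈0) (zeroʳ _))

  ≈-≉0 : ∀ {x y} → x ≈ y → x ≉ 0# → y ≉ 0#
  ≈-≉0 x≈y x≉0 y≈0 = x≉0 (trans x≈y y≈0)

  ⁻¹-≉0 : ∀ {x} → x ≉ 0# → x ⁻¹ ≉ 0#
  ⁻¹-≉0 x≉0 = factorʳ-≉0 (≈-≉0 (sym (⁻¹-inverseʳ x≉0)) 1≉0)

  -‿≉0 : ∀ {x} → x ≉ 0# → - x ≉ 0#
  -‿≉0 {x} x≉0 -x≈0 = x≉0 (begin
    x        ≈⟨ solve 1 (λ x → x := :- (:- x)) refl x ⟩
    - (- x)  ≈⟨ -‿cong -x≈0 ⟩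
    - 0#     ≈⟨ solve 0 (:- con (+ 0) := con (+ 0)) refl ⟩
    0#       ∎)

  -≈0⇒≈ : ∀ {x y} → x - y ≈ 0# → x ≈ y
  -≈0⇒≈ {x} {y} x-y≈0 = begin
    x            ≈⟨ solve 2 (λ x y → x := (x :- y) :+ y) refl x y ⟩
    (x - y) + y  ≈⟨ +-congʳ x-y≈0 ⟩
    0# + y       ≈⟨ +-identityˡ y ⟩
    y            ∎

  ≈⇒-≈0 : ∀ {x y} → x ≈ y → x - y ≈ 0#
  ≈⇒-≈0 {x} {y} x≈y = trans (+-congʳ x≈y) (-‿inverseʳ y)

module Matrices (K : Field c ℓ) where
  open Field K
  open FieldProperties K
  open SetoidReasoning setoid
  open IntegerSolver commutativeRing

  record Mat : Set c where
    constructor mat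
    field
      a₁₁ a₁₂ a₂₁ a₂₂ : Carrier

  open Mat

  infix 4 _≋_ _∼_
  infixl 7 _·_
  infixr 8 _•_

  record _≋_ (A B : Mat) : Set ℓ where
    constructor mat≋
    field
      e₁₁ : a₁₁ A ≈ a₁₁ B
      e₁₂ : a₁₂ A ≈ a₁₂ B
      e₂₁ : a₂₁ A ≈ a₂₁ B
      e₂₂ : a₂₂ A ≈ a₂₂ B

  open _≋_ public

  _·_ : Mat → Mat → Mat
  mat a b c d · mat a′ b′ c′ d′ =
    mat (a * a′ + b * c′) (a * b′ + b * d′) (c * a′ + d * c′) (c * b′ + d * d′)

  _•_ : Carrier → Mat → Mat
  t • mat a b c d = mat (t * a) (t * b) (t * c) (t * d)

  𝟙 : Mat
  𝟙 = mat 1# 0# 0# 1#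

  det : Mat → Carrier
  det (mat a b c d) = a * d - b * c

  adj : Mat → Mat
  adj (mat a b c d) = mat d (- b) (- c) a

  _∼_ : Mat → Mat → Set (c ⊔ ℓ)
  A ∼ B = ∃ λ t → t ≉ 0# × A ≋ t • B

  ≋⇒∼ : ∀ {A B} → A ≋ B → A ∼ B
  ≋⇒∼ (mat≋ p q r s) = 1# , 1≉0 , mat≋ (one p) (one q) (one r) (one s)
    where
    one : ∀ {x y} → x ≈ y → x ≈ 1# * y
    one x≈y = trans x≈y (sym (*-identityˡ _))

  ∼-refl : ∀ {A} → A ∼ A
  ∼-refl = ≋⇒∼ (mat≋ refl refl refl refl)

  ∼-sym : ∀ {A B} → A ∼ B → B ∼ A
  ∼-sym (t , t≉0 , mat≋ p q r s) =
    t ⁻¹ , ⁻¹-≉0 t≉0 , mat≋ (move p) (move q) (move r) (move s)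
    where
    move : ∀ {x y} → x ≈ t * y → y ≈ t ⁻¹ * x
    move {x} {y} x≈ty = begin
      y               ≈⟨ *-identityˡ y ⟨
      1# * y          ≈⟨ *-congʳ (⁻¹-inverseʳ t≉0) ⟨
      (t * t ⁻¹) * y  ≈⟨ solve 3 (λ t t′ y → (t :* t′) :* y := t′ :* (t :* y)) refl t (t ⁻¹) y ⟩
      t ⁻¹ * (t * y)  ≈⟨ *-congˡ x≈ty ⟨
      t ⁻¹ * x        ∎

  ∼-trans : ∀ {A B C} → A ∼ B → B ∼ C → A ∼ C
  ∼-trans (t , t≉0 , mat≋ p q r s) (u , u≉0 , mat≋ p′ q′ r′ s′) =
    t * u , *-≉0 t≉0 u≉0 , mat≋ (comp p p′) (comp q q′) (comp r r′) (comp s s′)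
    where
    comp : ∀ {x y z} → x ≈ t * y → y ≈ u * z → x ≈ (t * u) * z
    comp x≈ty y≈uz = trans x≈ty (trans (*-congˡ y≈uz) (sym (*-assoc t u _)))

  ·-cong : ∀ {A A′ B B′} → A ∼ A′ → B ∼ B′ → A · B ∼ A′ · B′
  ·-cong (t , t≉0 , mat≋ p q r s) (u , u≉0 , mat≋ p′ q′ r′ s′) =
    t * u , *-≉0 t≉0 u≉0 , mat≋ (row p q p′ r′) (row p q q′ s′) (row r s p′ r′) (row r s q′ s′)
    where
    row : ∀ {w x y z w′ x′ y′ z′} → w ≈ t * w′ → x ≈ t * x′ → y ≈ u * y′ → z ≈ u * z′ →
          w * y + x * z ≈ (t * u) * (w′ * y′ + x′ * z′)
    row {w′ = w′} {x′} {y′} {z′} p q r s = trans (+-cong (*-cong p r) (*-cong q s))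
      (solve 6 (λ t u w x y z → (t :* w) :* (u :* y) :+ (t :* x) :* (u :* z)
                             := (t :* u) :* (w :* y :+ x :* z)) refl t u w′ x′ y′ z′)

  ·-assoc : ∀ A B C → (A · B) · C ∼ A · (B · C)
  ·-assoc (mat a b c d) (mat a′ b′ c′ d′) (mat a″ b″ c″ d″) =
    ≋⇒∼ (mat≋ (entry a b a″ c″) (entry a b b″ d″) (entry c d a″ c″) (entry c d b″ d″))
    where
    entry : ∀ x y z w → (x * a′ + y * c′) * z + (x * b′ + y * d′) * w
                      ≈ x * (a′ * z + b′ * w) + y * (c′ * z + d′ * w)
    entry x y z w = solve 8 (λ a′ b′ c′ d′ x y z w →
      (x :* a′ :+ y :* c′) :* z :+ (x :* b′ :+ y :* d′) :* w
      := x :* (a′ :* z :+ b′ :* w) :+ y :* (c′ :* z :+ d′ :* w)) refl a′ b′ c′ d′ x y z w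

  10·ˡ : ∀ x y → 1# * x + 0# * y ≈ x
  10·ˡ = solve 2 (λ x y → con (+ 1) :* x :+ con (+ 0) :* y := x) refl

  01·ˡ : ∀ x y → 0# * x + 1# * y ≈ y
  01·ˡ = solve 2 (λ x y → con (+ 0) :* x :+ con (+ 1) :* y := y) refl

  10·ʳ : ∀ x y → x * 1# + y * 0# ≈ x
  10·ʳ = solve 2 (λ x y → x :* con (+ 1) :+ y :* con (+ 0) := x) refl

  01·ʳ : ∀ x y → x * 0# + y * 1# ≈ y
  01·ʳ = solve 2 (λ x y → x :* con (+ 0) :+ y :* con (+ 1) := y) refl

  ·-identityˡ : ∀ A → 𝟙 · A ∼ A
  ·-identityˡ (mat a b c d) = ≋⇒∼ (mat≋ (10·ˡ a c) (10·ˡ b d) (01·ˡ a c) (01·ˡ b d))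

  ·-identityʳ : ∀ A → A · 𝟙 ∼ A
  ·-identityʳ (mat a b c d) = ≋⇒∼ (mat≋ (10·ʳ a b) (01·ʳ a b) (10·ʳ c d) (01·ʳ c d))

  det-· : ∀ A B → det (A · B) ≈ det A * det B
  det-· (mat a b c d) (mat a′ b′ c′ d′) = solve 8 (λ a b c d a′ b′ c′ d′ →
    (a :* a′ :+ b :* c′) :* (c :* b′ :+ d :* d′) :- (a :* b′ :+ b :* d′) :* (c :* a′ :+ d :* c′)
    := (a :* d :- b :* c) :* (a′ :* d′ :- b′ :* c′)) refl a b c d a′ b′ c′ d′

  det-𝟙 : det 𝟙 ≈ 1#
  det-𝟙 = solve 0 (con (+ 1) :* con (+ 1) :- con (+ 0) :* con (+ 0) := con (+ 1)) refl

  det-adj : ∀ A → det (adj A) ≈ det A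
  det-adj (mat a b c d) =
    solve 4 (λ a b c d → d :* a :- (:- b) :* (:- c) := a :* d :- b :* c) refl a b c d

  det-• : ∀ t A → det (t • A) ≈ (t * t) * det A
  det-• t (mat a b c d) = solve 5 (λ t a b c d →
    (t :* a) :* (t :* d) :- (t :* b) :* (t :* c)
    := (t :* t) :* (a :* d :- b :* c)) refl t a b c d

  adj-inverseˡ : ∀ A → det A ≉ 0# → adj A · A ∼ 𝟙
  adj-inverseˡ A@(mat a b c d) detA≉0 = det A , detA≉0 , mat≋
    (solve 4 (λ a b c d → d :* a :+ (:- b) :* c := (a :* d :- b :* c) :* con (+ 1)) refl a b c d)
    (solve 4 (λ a b c d → d :* b :+ (:- b) :* d := (a :* d :- b :* c) :* con (+ 0)) refl a b c d)
    (solve 4 (λ a b c d → (:- c) :* a :+ a :* c := (a :* d :- b :* c) :* con (+ 0)) refl a b c d)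
    (solve 4 (λ a b c d → (:- c) :* b :+ a :* d := (a :* d :- b :* c) :* con (+ 1)) refl a b c d)

  adj-inverseʳ : ∀ A → det A ≉ 0# → A · adj A ∼ 𝟙
  adj-inverseʳ A@(mat a b c d) detA≉0 = det A , detA≉0 , mat≋
    (solve 4 (λ a b c d → a :* d :+ b :* (:- c) := (a :* d :- b :* c) :* con (+ 1)) refl a b c d)
    (solve 4 (λ a b c d → a :* (:- b) :+ b :* a := (a :* d :- b :* c) :* con (+ 0)) refl a b c d)
    (solve 4 (λ a b c d → c :* d :+ d :* (:- c) := (a :* d :- b :* c) :* con (+ 0)) refl a b c d)
    (solve 4 (λ a b c d → c :* (:- b) :+ d :* a := (a :* d :- b :* c) :* con (+ 1)) refl a b c d)

  adj-cong : ∀ {A B} → A ∼ B → adj A ∼ adj B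
  adj-cong (t , t≉0 , mat≋ p q r s) = t , t≉0 , mat≋ s (neg q) (neg r) p
    where
    neg : ∀ {x y} → x ≈ t * y → - x ≈ t * (- y)
    neg {y = y} x≈ty = trans (-‿cong x≈ty)
      (solve 2 (λ t y → :- (t :* y) := t :* (:- y)) refl t y)

  -- Matrices satisfying P, modulo scalars.  The inverse is the adjugate,
  -- which differs from the inverse matrix by the factor det A.

  projectiveGroup : (P : Mat → Set ℓ) → (∀ {A} → P A → det A ≉ 0#) →
                    P 𝟙 → (∀ {A B} → P A → P B → P (A · B)) → (∀ {A} → P A → P (adj A)) →
                    Group (c ⊔ ℓ) (c ⊔ ℓ)
  projectiveGroup P P⇒det≉0 P𝟙 P· Padj = record
    { Carrier = Σ Mat P
    ; _≈_     = λ A B → proj₁ A ∼ proj₁ B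
    ; _∙_     = λ A B → proj₁ A · proj₁ B , P· (proj₂ A) (proj₂ B)
    ; ε       = 𝟙 , P𝟙
    ; _⁻¹     = λ A → adj (proj₁ A) , Padj (proj₂ A)
    ; isGroup = record
      { isMonoid = record
        { isSemigroup = record
          { isMagma = record
            { isEquivalence = record { refl = ∼-refl ; sym = ∼-sym ; trans = ∼-trans }
            ; ∙-cong = ·-cong }
          ; assoc = λ A B C → ·-assoc (proj₁ A) (proj₁ B) (proj₁ C) }
        ; identity = (λ A → ·-identityˡ (proj₁ A)) , (λ A → ·-identityʳ (proj₁ A)) }
      ; inverse = (λ A → adj-inverseˡ (proj₁ A) (P⇒det≉0 (proj₂ A)))
                , (λ A → adj-inverseʳ (proj₁ A) (P⇒det≉0 (proj₂ A)))
      ; ⁻¹-cong = adj-cong } }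

  PGL₂ : Group (c ⊔ ℓ) (c ⊔ ℓ)
  PGL₂ = projectiveGroup (λ A → det A ≉ 0#) (λ p → p)
    (≈-≉0 (sym det-𝟙) 1≉0)
    (λ {A} {B} p q → ≈-≉0 (sym (det-· A B)) (*-≉0 p q))
    (λ {A} p → ≈-≉0 (sym (det-adj A)) p)

  -- A scalar relating two matrices of determinant 1 squares to 1, so this is
  -- SL(2,K) modulo ±𝟙.

  PSL₂ : Group (c ⊔ ℓ) (c ⊔ ℓ)
  PSL₂ = projectiveGroup (λ A → det A ≈ 1#) (λ p → ≈-≉0 (sym p) 1≉0)
    det-𝟙
    (λ {A} {B} p q → trans (det-· A B) (trans (*-cong p q) (*-identityˡ 1#)))
    (λ {A} p → trans (det-adj A) p)

open Matrices public using (PGL₂; PSL₂)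

IsPrimitiveRoot : (K : Field c ℓ) → ℕ → Field.Carrier K → Set ℓ
IsPrimitiveRoot K n ξ = HasOrder (Field.*-monoid K) ξ n

module Parameters (K : Field c ℓ) (ξκ ξλ : Field.Carrier K) where
  open Field K

  2# 4# : Carrier
  2# = 1# + 1#
  4# = 1# + 1# + 1# + 1#

  ωκ ωλ D η : Carrier
  ωκ = ξκ + ξκ ⁻¹
  ωλ = ξλ + ξλ ⁻¹
  D  = ωκ * ωκ + ωλ * ωλ - 4#
  η  = (ξκ - ξκ ⁻¹) ⁻¹

  -- √-D stands for any chosen square root of - D.

  module TripleMatrices (√-D : Carrier) where
    open Matrices K using (Mat; mat; _•_)

    β : Carrier
    β = - (√-D ⁻¹)

    matX matY matZ : Mat
    matX = (η * β) • mat D (D * ωλ * ξκ) (- (ωλ * ξκ ⁻¹)) (- D)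
    matY = β • mat 0# (ξκ * D) (ξκ ⁻¹) 0#
    matZ = β • mat 0# D 1# 0#

module TripleMap
  (K : Field c ℓ) {k l : ℕ} (3≤k : 3 ℕ.≤ k) (3≤l : 3 ℕ.≤ l) {ξκ ξλ : Field.Carrier K}
  (primκ : IsPrimitiveRoot K (2 ℕ.* k) ξκ) (primλ : IsPrimitiveRoot K (2 ℕ.* l) ξλ)
  (D≉0 : Field._≉_ K (Parameters.D K ξκ ξλ) (Field.0# K))
  {√-D : Field.Carrier K}
  (√-D²≈-D : Field._≈_ K (Field._*_ K √-D √-D) (Field.-_ K (Parameters.D K ξκ ξλ)))
  where
  open Field K
  open Parameters K ξκ ξλ
  open TripleMatrices √-D
  open FieldProperties K
  open Matrices K hiding (PGL₂; PSL₂)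
  open SetoidReasoning setoid
  open IntegerSolver commutativeRing

  _^_ : Carrier → ℕ → Carrier
  _^_ = pow *-monoid

  ^-double : ∀ x n → x ^ (2 ℕ.* n) ≈ (x ^ n) * (x ^ n)
  ^-double x n = trans (MonoidMult.×-homo-+ *-monoid x n (n ℕ.+ 0))
    (*-congˡ (reflexive (≡.cong (x ^_) (ℕₚ.+-identityʳ n))))

  ^-inverse : ∀ {x y} → x * y ≈ 1# → ∀ n → (x ^ n) * (y ^ n) ≈ 1#
  ^-inverse xy≈1 zero = *-identityˡ 1#
  ^-inverse {x} {y} xy≈1 (suc n) = begin
    (x * x ^ n) * (y * y ^ n)  ≈⟨ solve 4 (λ x y v w → (x :* v) :* (y :* w) := (x :* y) :* (v :* w)) refl x y (x ^ n) (y ^ n) ⟩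
    (x * y) * (x ^ n * y ^ n)  ≈⟨ *-cong xy≈1 (^-inverse xy≈1 n) ⟩
    1# * 1#                    ≈⟨ *-identityˡ 1# ⟩
    1#                         ∎

  primitive⇒≉0 : ∀ {n x} → IsPrimitiveRoot K n x → x ≉ 0#
  primitive⇒≉0 {suc n} (_ , x^n≈1 , _) = factorˡ-≉0 (≈-≉0 (sym x^n≈1) 1≉0)

  <-double : ∀ {m n} → m ℕ.< n → 2 ℕ.* m ℕ.< 2 ℕ.* n
  <-double = ℕₚ.*-monoʳ-< 2

  0<double : ∀ {m} → 0 ℕ.< m → 0 ℕ.< 2 ℕ.* m
  0<double {suc m} _ = s≤s z≤n

  -- For a primitive 2n-th root of unity x with n ≥ 3.

  x-x⁻¹≉0 : ∀ {n x} → 3 ℕ.≤ n → IsPrimitiveRoot K (2 ℕ.* n) x → x - x ⁻¹ ≉ 0#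
  x-x⁻¹≉0 {n} {x} 3≤n prim@(_ , _ , minimal) x-y≈0 =
    minimal 2 (s≤s z≤n) (<-double (ℕₚ.≤-trans (s≤s (s≤s z≤n)) 3≤n)) (begin
      x * (x * 1#)                       ≈⟨ solve 2 (λ x y → x :* (x :* con (+ 1))
                                               := con (+ 1) :+ (x :* (x :- y) :+ (x :* y :- con (+ 1)))) refl x (x ⁻¹) ⟩
      1# + (x * (x - x ⁻¹) + (x * x ⁻¹ - 1#))
        ≈⟨ +-congˡ (+-cong (*-congˡ x-y≈0) (≈⇒-≈0 (⁻¹-inverseʳ (primitive⇒≉0 prim)))) ⟩
      1# + (x * 0# + 0#)                 ≈⟨ solve 1 (λ x → con (+ 1) :+ (x :* con (+ 0) :+ con (+ 0)) := con (+ 1)) refl x ⟩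
      1#                                 ∎)

  x+x⁻¹≉0 : ∀ {n x} → 3 ℕ.≤ n → IsPrimitiveRoot K (2 ℕ.* n) x → x + x ⁻¹ ≉ 0#
  x+x⁻¹≉0 {n} {x} 3≤n prim@(_ , _ , minimal) x+y≈0 =
    minimal 4 (s≤s z≤n) (<-double 3≤n) (begin
      x ^ 4                             ≈⟨ solve 2 (λ x y → x :* (x :* (x :* (x :* con (+ 1))))
           := con (+ 1) :+ (x :* x :- con (+ 1)) :* (x :* (x :+ y) :- (x :* y :- con (+ 1)))) refl x (x ⁻¹) ⟩
      1# + (x * x - 1#) * (x * (x + x ⁻¹) - (x * x ⁻¹ - 1#))
        ≈⟨ +-congˡ (*-congˡ (+-cong (*-congˡ x+y≈0) (-‿cong (≈⇒-≈0 (⁻¹-inverseʳ (primitive⇒≉0 prim)))))) ⟩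
      1# + (x * x - 1#) * (x * 0# - 0#)
        ≈⟨ solve 1 (λ x → con (+ 1) :+ (x :* x :- con (+ 1)) :* (x :* con (+ 0) :- con (+ 0)) := con (+ 1)) refl x ⟩
      1#                                ∎)

  ξ′ μ δ : Carrier
  ξ′ = ξκ ⁻¹
  μ  = ξλ ⁻¹
  δ  = ξκ - ξ′

  ξ≉0 : ξκ ≉ 0#
  ξ≉0 = primitive⇒≉0 primκ

  ξξ′≈1 : ξκ * ξ′ ≈ 1#
  ξξ′≈1 = ⁻¹-inverseʳ ξ≉0

  λμ≈1 : ξλ * μ ≈ 1#
  λμ≈1 = ⁻¹-inverseʳ (primitive⇒≉0 primλ)

  δ≉0 : δ ≉ 0#
  δ≉0 = x-x⁻¹≉0 3≤k primκ

  η≉0 : η ≉ 0#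
  η≉0 = ⁻¹-≉0 δ≉0

  ωλ≉0 : ωλ ≉ 0#
  ωλ≉0 = x+x⁻¹≉0 3≤l primλ

  β≉0 : β ≉ 0#
  β≉0 = -‿≉0 (⁻¹-≉0 (factorˡ-≉0 (≈-≉0 (sym √-D²≈-D) (-‿≉0 D≉0))))

  e₁ e₂ e₃ : Carrier
  e₁ = ξκ * ξ′ - 1#
  e₂ = ξλ * μ - 1#
  e₃ = D - (ωλ * ωλ + δ * δ)

  e₁≈0 : e₁ ≈ 0#
  e₁≈0 = ≈⇒-≈0 ξξ′≈1

  e₂≈0 : e₂ ≈ 0#
  e₂≈0 = ≈⇒-≈0 λμ≈1

  e₃≈0 : e₃ ≈ 0#
  e₃≈0 = trans
    (solve 3 (λ x y w →
       ((x :+ y) :* (x :+ y) :+ w :* w :- (con (+ 1) :+ con (+ 1) :+ con (+ 1) :+ con (+ 1)))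
         :- (w :* w :+ (x :- y) :* (x :- y))
       := con (+ 4) :* (x :* y :- con (+ 1))) refl ξκ ξ′ ωλ)
    (trans (*-congˡ e₁≈0) (zeroʳ _))

  drop₃ : ∀ {x} p q r → x + p * e₁ + q * e₂ + r * e₃ ≈ x
  drop₃ {x} p q r = begin
    x + p * e₁ + q * e₂ + r * e₃  ≈⟨ +-cong (+-cong (+-congˡ (*-congˡ e₁≈0)) (*-congˡ e₂≈0)) (*-congˡ e₃≈0) ⟩
    x + p * 0# + q * 0# + r * 0#  ≈⟨ solve 4 (λ x p q r → x :+ p :* con (+ 0) :+ q :* con (+ 0) :+ r :* con (+ 0) := x) refl x p q r ⟩
    x                             ∎

  detX≉0 : det matX ≉ 0#
  detX≉0 = ≈-≉0 (sym (trans (det-• _ _) (*-congˡ (trans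
    (solve 4 (λ D w x y →
       D :* (:- D) :- (D :* w :* x) :* (:- (w :* y))
       := :- (D :* ((x :- y) :* (x :- y)))
          :+ (D :* (w :* w)) :* (x :* y :- con (+ 1))
          :+ con (+ 0) :* con (+ 0)
          :+ (:- D) :* (D :- (w :* w :+ (x :- y) :* (x :- y)))) refl D ωλ ξκ ξ′)
    (trans (+-congʳ (+-congˡ (*-congˡ (sym e₂≈0)))) (drop₃ _ _ _))))))
    (*-≉0 (*-≉0 ηβ≉0 ηβ≉0) (-‿≉0 (*-≉0 D≉0 (*-≉0 δ≉0 δ≉0))))
    where
    ηβ≉0 : η * β ≉ 0#
    ηβ≉0 = *-≉0 η≉0 β≉0

  detY≉0 : det matY ≉ 0#
  detY≉0 = ≈-≉0 (sym (trans (det-• _ _) (*-congˡ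
    (solve 3 (λ x y D → con (+ 0) :* con (+ 0) :- (x :* D) :* y := :- ((x :* y) :* D)) refl ξκ ξ′ D))))
    (*-≉0 (*-≉0 β≉0 β≉0) (-‿≉0 (*-≉0 (*-≉0 ξ≉0 (⁻¹-≉0 ξ≉0)) D≉0)))

  detZ≉0 : det matZ ≉ 0#
  detZ≉0 = ≈-≉0 (sym (trans (det-• _ _) (*-congˡ
    (solve 1 (λ D → con (+ 0) :* con (+ 0) :- D :* con (+ 1) := :- D) refl D))))
    (*-≉0 (*-≉0 β≉0 β≉0) (-‿≉0 D≉0))

  X Y Z : Group.Carrier (PGL₂ K)
  X = matX , detX≉0
  Y = matY , detY≉0
  Z = matZ , detZ≉0

  G : Group (c ⊔ ℓ) (c ⊔ ℓ)
  G = generatedSubgroup (PGL₂ K) X Y Z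

  module G = Group G

  matrix : G.Carrier → Mat
  matrix g = proj₁ (proj₁ g)

  gX gY gZ : G.Carrier
  gX = X , genX
  gY = Y , genY
  gZ = Z , genZ

  generated : ∀ g → Generated G gX gY gZ g
  generated (g , h) = go h
    where
    go : ∀ {g} (h : Generated (PGL₂ K) X Y Z g) → Generated G gX gY gZ (g , h)
    go genX           = genX
    go genY           = genY
    go genZ           = genZ
    go genε           = genε
    go (gen∙ h h′)    = gen∙ (go h) (go h′)
    go (gen⁻¹ h)      = gen⁻¹ (go h)
    go (gen≈ g≈g′ h)  = gen≈ g≈g′ (go h)

  ∼𝟙⇒a₁₂≈0 : ∀ {A} → A ∼ 𝟙 → Mat.a₁₂ A ≈ 0#
  ∼𝟙⇒a₁₂≈0 (t , _ , A≋t) = trans (e₁₂ A≋t) (zeroʳ t)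

  involution : ∀ g → Mat.a₁₁ (matrix g) + Mat.a₂₂ (matrix g) ≈ 0# →
               Mat.a₁₂ (matrix g) ≉ 0# → HasOrder G.monoid g 2
  involution g@((mat a b c d , det≉0) , _) tr≈0 b≉0 =
    s≤s z≤n , ∼-trans (·-cong {mat a b c d} ∼-refl (·-identityʳ (mat a b c d))) square , minimal
    where
    scalar : ∀ {x y} z → x ≈ y + z * (a + d) → x ≈ y
    scalar {x} {y} z x≈ = begin
      x                ≈⟨ x≈ ⟩
      y + z * (a + d)  ≈⟨ +-congˡ (trans (*-congˡ tr≈0) (zeroʳ z)) ⟩
      y + 0#           ≈⟨ +-identityʳ y ⟩
      y                ∎

    square : mat a b c d · mat a b c d ∼ 𝟙
    square = - (a * d - b * c) , -‿≉0 det≉0 , mat≋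
      (scalar a (solve 4 (λ a b c d → a :* a :+ b :* c := (:- (a :* d :- b :* c)) :* con (+ 1) :+ a :* (a :+ d)) refl a b c d))
      (scalar b (solve 4 (λ a b c d → a :* b :+ b :* d := (:- (a :* d :- b :* c)) :* con (+ 0) :+ b :* (a :+ d)) refl a b c d))
      (scalar c (solve 4 (λ a b c d → c :* a :+ d :* c := (:- (a :* d :- b :* c)) :* con (+ 0) :+ c :* (a :+ d)) refl a b c d))
      (scalar d (solve 4 (λ a b c d → c :* b :+ d :* d := (:- (a :* d :- b :* c)) :* con (+ 1) :+ d :* (a :+ d)) refl a b c d))

    minimal : ∀ m → 0 ℕ.< m → m ℕ.< 2 → ¬ (pow G.monoid g m G.≈ G.ε)
    minimal (suc zero) _ _ g∙ε≈ε =
      b≉0 (∼𝟙⇒a₁₂≈0 (∼-trans (∼-sym (·-identityʳ (mat a b c d))) g∙ε≈ε))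
    minimal (suc (suc m)) _ (s≤s (s≤s ())) _

  -- F n is a closed form, up to scalars, for the n-th power of g.

  rotation : ∀ g {n ζ} → 3 ℕ.≤ n → IsPrimitiveRoot K (2 ℕ.* n) ζ → (F : ℕ → Mat) →
             F 0 ∼ 𝟙 → (∀ m → matrix g · F m ∼ F (suc m)) →
             (∀ m → F m ∼ 𝟙 → (ζ ^ m) * (ζ ^ m) ≈ 1#) →
             (∀ m → (ζ ^ m) * (ζ ^ m) ≈ 1# → F m ∼ 𝟙) →
             HasOrder G.monoid g n
  rotation g {n} {ζ} 3≤n (_ , ζ^2n≈1 , minimal) F F0 Fsuc to from =
      ℕₚ.≤-trans (s≤s z≤n) 3≤n
    , ∼-trans (powF n) (from n (trans (sym (^-double ζ n)) ζ^2n≈1))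
    , λ m 0<m m<n gm≈ε → minimal (2 ℕ.* m) (0<double 0<m) (<-double m<n)
        (trans (^-double ζ m) (to m (∼-trans (∼-sym (powF m)) gm≈ε)))
    where
    powF : ∀ m → matrix (pow G.monoid g m) ∼ F m
    powF zero    = ∼-sym F0
    powF (suc m) = ∼-trans (·-cong {matrix g} ∼-refl (powF m)) (Fsuc m)

  βD≉0 : β * D ≉ 0#
  βD≉0 = *-≉0 β≉0 D≉0

  X-order : HasOrder G.monoid gX 2
  X-order = involution gX
    (solve 2 (λ D t → t :* D :+ t :* (:- D) := con (+ 0)) refl D (η * β))
    (*-≉0 (*-≉0 η≉0 β≉0) (*-≉0 (*-≉0 D≉0 ωλ≉0) ξ≉0))

  Y-order : HasOrder G.monoid gY 2
  Y-order = involution gY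
    (solve 1 (λ b → b :* con (+ 0) :+ b :* con (+ 0) := con (+ 0)) refl β)
    (*-≉0 β≉0 (*-≉0 ξ≉0 D≉0))

  Z-order : HasOrder G.monoid gZ 2
  Z-order = involution gZ
    (solve 1 (λ b → b :* con (+ 0) :+ b :* con (+ 0) := con (+ 0)) refl β)
    βD≉0

  XY-order : HasOrder G.monoid (gX G.∙ gY) 2
  XY-order = involution (gX G.∙ gY)
    (solve 6 (λ t b D w x y →
       ((t :* D) :* (b :* con (+ 0)) :+ (t :* (D :* w :* x)) :* (b :* y))
       :+ ((t :* (:- (w :* y))) :* (b :* (x :* D)) :+ (t :* (:- D)) :* (b :* con (+ 0)))
       := con (+ 0)) refl (η * β) β D ωλ ξκ ξ′)
    (≈-≉0 (solve 5 (λ t b D w x →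
       (t :* D) :* (b :* (x :* D))
       := (t :* D) :* (b :* (x :* D)) :+ (t :* (D :* w :* x)) :* (b :* con (+ 0))) refl (η * β) β D ωλ ξκ)
      (*-≉0 (*-≉0 (*-≉0 η≉0 β≉0) D≉0) (*-≉0 β≉0 (*-≉0 ξ≉0 D≉0))))

  YZ-order : HasOrder G.monoid (gY G.∙ gZ) k
  YZ-order = rotation (gY G.∙ gZ) 3≤k primκ F ∼-refl Fsuc to from
    where
    F : ℕ → Mat
    F m = mat (ξκ ^ m) 0# 0# (ξ′ ^ m)

    Fsuc : ∀ m → (matY · matZ) · F m ∼ F (suc m)
    Fsuc m = β * (β * D) , *-≉0 β≉0 βD≉0 , mat≋
      (solve 4 (λ b D x v →
         ((b :* con (+ 0)) :* (b :* con (+ 0)) :+ (b :* (x :* D)) :* (b :* con (+ 1))) :* v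
         :+ ((b :* con (+ 0)) :* (b :* D) :+ (b :* (x :* D)) :* (b :* con (+ 0))) :* con (+ 0)
         := (b :* (b :* D)) :* (x :* v)) refl β D ξκ (ξκ ^ m))
      (solve 4 (λ b D x v →
         ((b :* con (+ 0)) :* (b :* con (+ 0)) :+ (b :* (x :* D)) :* (b :* con (+ 1))) :* con (+ 0)
         :+ ((b :* con (+ 0)) :* (b :* D) :+ (b :* (x :* D)) :* (b :* con (+ 0))) :* v
         := (b :* (b :* D)) :* con (+ 0)) refl β D ξκ (ξ′ ^ m))
      (solve 4 (λ b D y v →
         ((b :* y) :* (b :* con (+ 0)) :+ (b :* con (+ 0)) :* (b :* con (+ 1))) :* v
         :+ ((b :* y) :* (b :* D) :+ (b :* con (+ 0)) :* (b :* con (+ 0))) :* con (+ 0)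
         := (b :* (b :* D)) :* con (+ 0)) refl β D ξ′ (ξκ ^ m))
      (solve 4 (λ b D y v →
         ((b :* y) :* (b :* con (+ 0)) :+ (b :* con (+ 0)) :* (b :* con (+ 1))) :* con (+ 0)
         :+ ((b :* y) :* (b :* D) :+ (b :* con (+ 0)) :* (b :* con (+ 0))) :* v
         := (b :* (b :* D)) :* (y :* v)) refl β D ξ′ (ξ′ ^ m))

    to : ∀ m → F m ∼ 𝟙 → (ξκ ^ m) * (ξκ ^ m) ≈ 1#
    to m (t , _ , F≋t) = trans (*-congˡ (trans (e₁₁ F≋t) (sym (e₂₂ F≋t)))) (^-inverse ξξ′≈1 m)

    from : ∀ m → (ξκ ^ m) * (ξκ ^ m) ≈ 1# → F m ∼ 𝟙
    from m vv≈1 = v , factorˡ-≉0 (≈-≉0 (sym vv≈1) 1≉0) ,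
      mat≋ (sym (*-identityʳ v)) (sym (zeroʳ v)) (sym (zeroʳ v)) (begin
        v′             ≈⟨ *-identityʳ v′ ⟨
        v′ * 1#        ≈⟨ *-congˡ vv≈1 ⟨
        v′ * (v * v)   ≈⟨ solve 2 (λ v v′ → v′ :* (v :* v) := v :* (v :* v′)) refl v v′ ⟩
        v * (v * v′)   ≈⟨ *-congˡ (^-inverse ξξ′≈1 m) ⟩
        v * 1#         ∎)
      where
      v v′ : Carrier
      v  = ξκ ^ m
      v′ = ξ′ ^ m

  ZX-order : HasOrder G.monoid (gZ G.∙ gX) l
  ZX-order = rotation (gZ G.∙ gX) 3≤l primλ F (scalar 0 refl) Fsuc to from
    where
    d : Carrier
    d = D * δ

    -- ZX is a multiple of a matrix A with A² = d ωλ A - d², so that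
    -- (ξλ - μ) Aᵐ is d^(m-1) times F m by Cayley-Hamilton.
    entries : (s u : Carrier) → Mat
    entries s u = mat (- (s * D * ωλ * ξ′) - d * u) (- (s * D * D)) (s * D) (s * D * ωλ * ξκ - d * u)

    F : ℕ → Mat
    F m = entries (ξλ ^ m - μ ^ m) (ξλ ^ m * μ - μ ^ m * ξλ)

    Fsuc : ∀ m → (matZ · matX) · F m ∼ F (suc m)
    Fsuc m = (η * β) * β * d , *-≉0 (*-≉0 (*-≉0 η≉0 β≉0) β≉0) (*-≉0 D≉0 δ≉0) , mat≋
      (trans (solve 9 (λ t b D x y p q v w →
         let ω = p :+ q ; δ = x :- y ; d = D :* δ ; s = v :- w ; u = v :* q :- w :* p
             s′ = p :* v :- q :* w ; u′ = (p :* v) :* q :- (q :* w) :* p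
             z₁₁ = (b :* con (+ 0)) :* (t :* D) :+ (b :* D) :* (t :* (:- (ω :* y)))
             z₁₂ = (b :* con (+ 0)) :* (t :* (D :* ω :* x)) :+ (b :* D) :* (t :* (:- D))
         in z₁₁ :* (:- (s :* D :* ω :* y) :- d :* u) :+ z₁₂ :* (s :* D)
         := (t :* b :* d) :* (:- (s′ :* D :* ω :* y) :- d :* u′)
            :+ (t :* b :* (s :* D :* D :* ω :* ω)) :* (x :* y :- con (+ 1))
            :+ (t :* b :* (d :* d :* s)) :* (p :* q :- con (+ 1))
            :+ (t :* b :* (:- (s :* D :* D))) :* (D :- (ω :* ω :+ δ :* δ)))
         refl (η * β) β D ξκ ξ′ ξλ μ (ξλ ^ m) (μ ^ m)) (drop₃ _ _ _))
      (solve 9 (λ t b D x y p q v w →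
         let ω = p :+ q ; δ = x :- y ; d = D :* δ ; s = v :- w ; u = v :* q :- w :* p
             s′ = p :* v :- q :* w
             z₁₁ = (b :* con (+ 0)) :* (t :* D) :+ (b :* D) :* (t :* (:- (ω :* y)))
             z₁₂ = (b :* con (+ 0)) :* (t :* (D :* ω :* x)) :+ (b :* D) :* (t :* (:- D))
         in z₁₁ :* (:- (s :* D :* D)) :+ z₁₂ :* (s :* D :* ω :* x :- d :* u)
         := (t :* b :* d) :* (:- (s′ :* D :* D)))
         refl (η * β) β D ξκ ξ′ ξλ μ (ξλ ^ m) (μ ^ m))
      (solve 9 (λ t b D x y p q v w →
         let ω = p :+ q ; δ = x :- y ; d = D :* δ ; s = v :- w ; u = v :* q :- w :* p
             s′ = p :* v :- q :* w
             z₂₁ = (b :* con (+ 1)) :* (t :* D) :+ (b :* con (+ 0)) :* (t :* (:- (ω :* y)))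
             z₂₂ = (b :* con (+ 1)) :* (t :* (D :* ω :* x)) :+ (b :* con (+ 0)) :* (t :* (:- D))
         in z₂₁ :* (:- (s :* D :* ω :* y) :- d :* u) :+ z₂₂ :* (s :* D)
         := (t :* b :* d) :* (s′ :* D))
         refl (η * β) β D ξκ ξ′ ξλ μ (ξλ ^ m) (μ ^ m))
      (trans (solve 9 (λ t b D x y p q v w →
         let ω = p :+ q ; δ = x :- y ; d = D :* δ ; s = v :- w ; u = v :* q :- w :* p
             s′ = p :* v :- q :* w ; u′ = (p :* v) :* q :- (q :* w) :* p
             z₂₁ = (b :* con (+ 1)) :* (t :* D) :+ (b :* con (+ 0)) :* (t :* (:- (ω :* y)))
             z₂₂ = (b :* con (+ 1)) :* (t :* (D :* ω :* x)) :+ (b :* con (+ 0)) :* (t :* (:- D))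
         in z₂₁ :* (:- (s :* D :* D)) :+ z₂₂ :* (s :* D :* ω :* x :- d :* u)
         := (t :* b :* d) :* (s′ :* D :* ω :* x :- d :* u′)
            :+ (t :* b :* (s :* D :* D :* ω :* ω)) :* (x :* y :- con (+ 1))
            :+ (t :* b :* (d :* d :* s)) :* (p :* q :- con (+ 1))
            :+ (t :* b :* (:- (s :* D :* D))) :* (D :- (ω :* ω :+ δ :* δ)))
         refl (η * β) β D ξκ ξ′ ξλ μ (ξλ ^ m) (μ ^ m)) (drop₃ _ _ _))

    scalar : ∀ m → ξλ ^ m ≈ μ ^ m → F m ∼ 𝟙
    scalar m v≈w = d * (v * (ξλ - μ)) ,
      *-≉0 (*-≉0 D≉0 δ≉0) (*-≉0 v≉0 (x-x⁻¹≉0 3≤l primλ)) , mat≋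
      (drop (solve 8 (λ D x y w p q v v′ →
         let d = D :* (x :- y) ; s = v :- v′ in
         :- (s :* D :* w :* y) :- d :* (v :* q :- v′ :* p)
         := d :* (v :* (p :- q)) :* con (+ 1) :+ (:- (D :* w :* y :+ d :* p)) :* s) refl D ξκ ξ′ ωλ ξλ μ v v′))
      (drop (solve 7 (λ D x y p q v v′ →
         let d = D :* (x :- y) ; s = v :- v′ in
         :- (s :* D :* D) := d :* (v :* (p :- q)) :* con (+ 0) :+ (:- (D :* D)) :* s) refl D ξκ ξ′ ξλ μ v v′))
      (drop (solve 7 (λ D x y p q v v′ →
         let d = D :* (x :- y) ; s = v :- v′ in
         s :* D := d :* (v :* (p :- q)) :* con (+ 0) :+ D :* s) refl D ξκ ξ′ ξλ μ v v′))
      (drop (solve 8 (λ D x y w p q v v′ →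
         let d = D :* (x :- y) ; s = v :- v′ in
         s :* D :* w :* x :- d :* (v :* q :- v′ :* p)
         := d :* (v :* (p :- q)) :* con (+ 1) :+ (D :* w :* x :- d :* p) :* s) refl D ξκ ξ′ ωλ ξλ μ v v′))
      where
      v v′ : Carrier
      v  = ξλ ^ m
      v′ = μ ^ m

      v≉0 : v ≉ 0#
      v≉0 = factorˡ-≉0 (≈-≉0 (sym (^-inverse λμ≈1 m)) 1≉0)

      drop : ∀ {x y z} → x ≈ y + z * (v - v′) → x ≈ y
      drop {x} {y} {z} x≈ = trans x≈ (trans
        (+-congˡ (trans (*-congˡ (≈⇒-≈0 v≈w)) (zeroʳ z))) (+-identityʳ y))

    to : ∀ m → F m ∼ 𝟙 → (ξλ ^ m) * (ξλ ^ m) ≈ 1#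
    to m (t , _ , F≋t) = trans (*-congˡ (-≈0⇒≈ (*-cancelˡ-0 D≉0
      (trans (*-comm D _) (trans (e₂₁ F≋t) (zeroʳ t)))))) (^-inverse λμ≈1 m)

    from : ∀ m → (ξλ ^ m) * (ξλ ^ m) ≈ 1# → F m ∼ 𝟙
    from m vv≈1 = scalar m (-≈0⇒≈ (*-cancelˡ-0 v≉0 (begin
        v * (v - w)      ≈⟨ solve 2 (λ v w → v :* (v :- w) := v :* v :- v :* w) refl v w ⟩
        v * v - v * w    ≈⟨ ≈⇒-≈0 (trans vv≈1 (sym (^-inverse λμ≈1 m))) ⟩
        0#               ∎)))
      where
      v w : Carrier
      v = ξλ ^ m
      w = μ ^ m

      v≉0 : v ≉ 0#
      v≉0 = factorˡ-≉0 (≈-≉0 (sym vv≈1) 1≉0)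

  regularMap : RegularMap (c ⊔ ℓ) (c ⊔ ℓ) k l
  regularMap = record
    { group = G
    ; X = gX ; Y = gY ; Z = gZ
    ; X-order = X-order ; Y-order = Y-order ; Z-order = Z-order
    ; XY-order = XY-order ; YZ-order = YZ-order ; ZX-order = ZX-order
    ; generated = generated }

{-# OPTIONS --safe #-}

-- In PGL(2,K) the rotation R = YZ is diag(ξκ, ξκ⁻¹).  If k = 2m then ξκᵐ squares
-- to -1, so Rᵐ is J = diag(1, -1).  Up to a scalar, X J X has diagonal entries
-- ± (D + ωλ²) and off-diagonal entries 2 ωλ times those of J Y, whose diagonal
-- is 0.  Hence X J X = J Y exactly when D + ωλ² = 0.

module Submission where

open import Defs
open import Data.Integer.Base using (+_)
open import Data.Nat.Base using (ℕ; zero; suc; NonZero; _≤_; _<_; _*_; _^_; z≤n; s≤s)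
open import Data.Nat.Coprimality using (Coprime)
open import Data.Nat.DivMod using (_/_; m*n/n≡m)
open import Data.Nat.Divisibility using (_∣_; divides)
open import Data.Nat.Primality using (Prime)
import Data.Nat.Properties as ℕₚ
open import Data.Product.Base using (_×_; _,_; proj₁; proj₂)
open import Data.Sum.Base using (_⊎_)
open import Function.Bundles using (_⇔_; mk⇔)
open import Relation.Binary.PropositionalEquality as ≡ using (_≡_; _≢_)
import Relation.Binary.Reasoning.Setoid as SetoidReasoning

module TripleMapProperties
  {c ℓ} (K : Field c ℓ) {k l : ℕ} (3≤k : 3 ≤ k) (3≤l : 3 ≤ l) {ξκ ξλ : Field.Carrier K}
  (primκ : IsPrimitiveRoot K (2 * k) ξκ) (primλ : IsPrimitiveRoot K (2 * l) ξλ)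
  (D≉0 : Field._≉_ K (Parameters.D K ξκ ξλ) (Field.0# K))
  {√-D : Field.Carrier K}
  (√-D²≈-D : Field._≈_ K (Field._*_ K √-D √-D) (Field.-_ K (Parameters.D K ξκ ξλ)))
  where
  open Field K renaming (_*_ to _⊛_)
  open Parameters K ξκ ξλ
  open TripleMatrices √-D
  open FieldProperties K
  open Matrices K hiding (PGL₂; PSL₂)
  open SetoidReasoning setoid
  open IntegerSolver commutativeRing
  open TripleMap K 3≤k 3≤l primκ primλ D≉0 √-D²≈-D renaming (_^_ to _↑_)

  -- The ring solver proves only identities valid in every commutative ring. An equation that
  -- depends on a relation `e ≈ 0` is therefore proved with an explicit multiple of `e` on the
  -- right, which is discarded here.
  drop-multiple : ∀ {x y z e} → e ≈ 0# → x ≈ y + z ⊛ e → x ≈ y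
  drop-multiple {z = z} e≈0 x≈ =
    trans x≈ (trans (+-congˡ (trans (*-congˡ e≈0) (zeroʳ z))) (+-identityʳ _))

  -- `X₀` and `Y₀` are `matX` and `matY` without the scalars `η ⊛ β` and `β`, which `∼` does not
  -- see; dropping them keeps the entries polynomial in `D`, `ωλ`, `ξκ` and `ξ′`.
  X₀ Y₀ J : Mat
  X₀ = mat D (D ⊛ ωλ ⊛ ξκ) (- (ωλ ⊛ ξ′)) (- D)
  Y₀ = mat 0# (ξκ ⊛ D) ξ′ 0#
  J  = mat 1# 0# 0# (- 1#)

  •-∼ : ∀ {t A} → t ≉ 0# → t • A ∼ A
  •-∼ {t} t≉0 = t , t≉0 , mat≋ refl refl refl refl

  matX∼X₀ : matX ∼ X₀
  matX∼X₀ = •-∼ (*-≉0 η≉0 β≉0)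

  matY∼Y₀ : matY ∼ Y₀
  matY∼Y₀ = •-∼ β≉0

  YZ∼ : matY · matZ ∼ mat ξκ 0# 0# ξ′
  -- Both factors are antidiagonal, so the product is diagonal, with `β ⊛ (β ⊛ D)` common to its two
  -- entries.
  YZ∼ = β ⊛ (β ⊛ D) , *-≉0 β≉0 βD≉0 , mat≋
    (solve 3 (λ b D x →
       (b :* con (+ 0)) :* (b :* con (+ 0)) :+ (b :* (x :* D)) :* (b :* con (+ 1))
       := (b :* (b :* D)) :* x) refl β D ξκ)
    (solve 3 (λ b D x →
       (b :* con (+ 0)) :* (b :* D) :+ (b :* (x :* D)) :* (b :* con (+ 0))
       := (b :* (b :* D)) :* con (+ 0)) refl β D ξκ)
    (solve 3 (λ b D y →
       (b :* y) :* (b :* con (+ 0)) :+ (b :* con (+ 0)) :* (b :* con (+ 1))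
       := (b :* (b :* D)) :* con (+ 0)) refl β D ξ′)
    (solve 3 (λ b D y →
       (b :* y) :* (b :* D) :+ (b :* con (+ 0)) :* (b :* con (+ 0))
       := (b :* (b :* D)) :* y) refl β D ξ′)

  diag-· : ∀ a d a′ d′ → mat a 0# 0# d · mat a′ 0# 0# d′ ∼ mat (a ⊛ a′) 0# 0# (d ⊛ d′)
  diag-· a d a′ d′ = ≋⇒∼ (mat≋
    (solve 2 (λ a a′ → a :* a′ :+ con (+ 0) :* con (+ 0) := a :* a′) refl a a′)
    (solve 2 (λ a d′ → a :* con (+ 0) :+ con (+ 0) :* d′ := con (+ 0)) refl a d′)
    (solve 2 (λ d a′ → con (+ 0) :* a′ :+ d :* con (+ 0) := con (+ 0)) refl d a′)
    (solve 2 (λ d d′ → con (+ 0) :* con (+ 0) :+ d :* d′ := d :* d′) refl d d′))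

  R^∼diag : ∀ m → matrix (pow G.monoid (gY G.∙ gZ) m) ∼ mat (ξκ ↑ m) 0# 0# (ξ′ ↑ m)
  R^∼diag zero    = ∼-refl
  R^∼diag (suc m) = ∼-trans (·-cong YZ∼ (R^∼diag m)) (diag-· ξκ ξ′ (ξκ ↑ m) (ξ′ ↑ m))

  module _ m (k≡m*2 : k ≡ m * 2) where
    private
      v v′ : Carrier
      v  = ξκ ↑ m
      v′ = ξ′ ↑ m

      k≡2*m : k ≡ 2 * m
      k≡2*m = ≡.trans k≡m*2 (ℕₚ.*-comm m 2)

      0<k : 0 < k
      0<k = ℕₚ.≤-trans (s≤s z≤n) 3≤k

      k<2k : k < 2 * k
      k<2k = ℕₚ.m<m+n k (ℕₚ.≤-trans 0<k (ℕₚ.m≤m+n k 0))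

      -- `v ⊛ v` is `ξκ ↑ k`, and `k` lies strictly between 0 and the order `2 * k` of `ξκ`.
      vv≉1 : v ⊛ v ≉ 1#
      vv≉1 vv≈1 = proj₂ (proj₂ primκ) k 0<k k<2k
        (trans (reflexive (≡.cong (ξκ ↑_) k≡2*m)) (trans (^-double ξκ m) vv≈1))

      -- The fourth power of `v` is `ξκ ↑ (2 * k)`, that is 1, so the product of `v ⊛ v - 1#` and
      -- `v ⊛ v + 1#` vanishes, and the first factor is nonzero.
      vv≈-1 : v ⊛ v ≈ - 1#
      vv≈-1 = -≈0⇒≈ (*-cancelˡ-0 (λ e → vv≉1 (-≈0⇒≈ e)) (begin
        (v ⊛ v - 1#) ⊛ (v ⊛ v - - 1#)
          ≈⟨ solve 1 (λ v → (v :* v :- con (+ 1)) :* (v :* v :- (:- con (+ 1)))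
                         := (v :* v) :* (v :* v) :- con (+ 1)) refl v ⟩
        (v ⊛ v) ⊛ (v ⊛ v) - 1#
          ≈⟨ ≈⇒-≈0 (begin
               (v ⊛ v) ⊛ (v ⊛ v)            ≈⟨ *-cong (^-double ξκ m) (^-double ξκ m) ⟨
               (ξκ ↑ (2 * m)) ⊛ (ξκ ↑ (2 * m)) ≡⟨ ≡.cong (λ n → (ξκ ↑ n) ⊛ (ξκ ↑ n)) k≡2*m ⟨
               (ξκ ↑ k) ⊛ (ξκ ↑ k)          ≈⟨ ^-double ξκ k ⟨
               ξκ ↑ (2 * k)                 ≈⟨ proj₁ (proj₂ primκ) ⟩
               1#                           ∎) ⟩
        0#  ∎))

    -- If 2 were 0, then 1 and -1 would coincide, and `vv≈-1` would contradict `vv≉1`.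
    2≉0 : 2# ≉ 0#
    2≉0 2≈0 = vv≉1 (trans vv≈-1 (sym (-≈0⇒≈
      (trans (solve 0 (con (+ 1) :- (:- con (+ 1)) := con (+ 1) :+ con (+ 1)) refl) 2≈0))))

    R^m∼J : matrix (pow G.monoid (gY G.∙ gZ) m) ∼ J
    R^m∼J = ∼-trans (R^∼diag m)
      ( v , factorˡ-≉0 (≈-≉0 (sym vv′≈1) 1≉0)
      , mat≋ (sym (*-identityʳ v)) (sym (zeroʳ v)) (sym (zeroʳ v)) v′≈-v )
      where
      vv′≈1 : v ⊛ v′ ≈ 1#
      vv′≈1 = ^-inverse ξξ′≈1 m

      -- `v′` is the inverse of `v`, and so is `- v` because `v ⊛ v ≈ - 1#`. Hence diag(`v`, `v′`)
      -- is `v` times `J`.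
      v′≈-v : v′ ≈ v ⊛ - 1#
      v′≈-v = begin
        v′                  ≈⟨ solve 1 (λ v′ → v′ := (:- v′) :* (:- con (+ 1))) refl v′ ⟩
        (- v′) ⊛ (- 1#)     ≈⟨ *-congˡ vv≈-1 ⟨
        (- v′) ⊛ (v ⊛ v)    ≈⟨ solve 2 (λ v v′ → (:- v′) :* (v :* v) := (v :* v′) :* (v :* (:- con (+ 1)))) refl v v′ ⟩
        (v ⊛ v′) ⊛ (v ⊛ - 1#) ≈⟨ *-congʳ vv′≈1 ⟩
        1# ⊛ (v ⊛ - 1#)     ≈⟨ *-identityˡ _ ⟩
        v ⊛ - 1#            ∎

  -- The off-diagonal entries of `X₀` contribute `ωλ ⊛ ωλ` with a factor `ξκ ⊛ ξ′`, which `e₁≈0`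
  -- replaces by 1.
  XJX₁₁ : Mat.a₁₁ (X₀ · J · X₀) ≈ D ⊛ (D + ωλ ⊛ ωλ)
  XJX₁₁ = drop-multiple e₁≈0 (solve 4 (λ D w x y →
    (D :* con (+ 1) :+ (D :* w :* x) :* con (+ 0)) :* D
      :+ (D :* con (+ 0) :+ (D :* w :* x) :* (:- con (+ 1))) :* (:- (w :* y))
    := D :* (D :+ w :* w) :+ (D :* (w :* w)) :* (x :* y :- con (+ 1))) refl D ωλ ξκ ξ′)

  XJX₂₂ : Mat.a₂₂ (X₀ · J · X₀) ≈ - D ⊛ (D + ωλ ⊛ ωλ)
  XJX₂₂ = drop-multiple e₁≈0 (solve 4 (λ D w x y →
    ((:- (w :* y)) :* con (+ 1) :+ (:- D) :* con (+ 0)) :* (D :* w :* x)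
      :+ ((:- (w :* y)) :* con (+ 0) :+ (:- D) :* (:- con (+ 1))) :* (:- D)
    := (:- D) :* (D :+ w :* w) :+ (:- (D :* (w :* w))) :* (x :* y :- con (+ 1))) refl D ωλ ξκ ξ′)

  JY₁₁ : Mat.a₁₁ (J · Y₀) ≈ 0#
  JY₁₁ = solve 1 (λ y → con (+ 1) :* con (+ 0) :+ con (+ 0) :* y := con (+ 0)) refl ξ′

  JY₂₂ : Mat.a₂₂ (J · Y₀) ≈ 0#
  JY₂₂ = solve 2 (λ x D → con (+ 0) :* (x :* D) :+ (:- con (+ 1)) :* con (+ 0) := con (+ 0)) refl ξκ D

  -- The upper left entry suffices: it is 0 in `J · Y₀`, hence in every scalar multiple, and `D`
  -- cancels.
  XJX∼JY⇒ : X₀ · J · X₀ ∼ J · Y₀ → D + ωλ ⊛ ωλ ≈ 0#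
  XJX∼JY⇒ (t , _ , XJX≋) = *-cancelˡ-0 D≉0 (begin
    D ⊛ (D + ωλ ⊛ ωλ)          ≈⟨ XJX₁₁ ⟨
    Mat.a₁₁ (X₀ · J · X₀)      ≈⟨ e₁₁ XJX≋ ⟩
    t ⊛ Mat.a₁₁ (J · Y₀)       ≈⟨ *-congˡ JY₁₁ ⟩
    t ⊛ 0#                     ≈⟨ zeroʳ t ⟩
    0#                         ∎)

  ⇒XJX∼JY : 2# ≉ 0# → D + ωλ ⊛ ωλ ≈ 0# → X₀ · J · X₀ ∼ J · Y₀
  -- The ratio of the off-diagonal entries is `t` whatever the value of `D + ωλ ⊛ ωλ`; the
  -- hypothesis only makes the diagonal vanish. That `ωλ` is nonzero comes from `l` being at least
  -- 3.
  ⇒XJX∼JY 2≉0 D+ω²≈0 = t , *-≉0 (*-≉0 2≉0 D≉0) ωλ≉0 , mat≋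
    (trans XJX₁₁ (zeros D JY₁₁))
    (solve 4 (λ D w x y →
      (D :* con (+ 1) :+ (D :* w :* x) :* con (+ 0)) :* (D :* w :* x)
        :+ (D :* con (+ 0) :+ (D :* w :* x) :* (:- con (+ 1))) :* (:- D)
      := ((con (+ 1) :+ con (+ 1)) :* D :* w) :* (con (+ 1) :* (x :* D) :+ con (+ 0) :* con (+ 0)))
      refl D ωλ ξκ ξ′)
    (solve 3 (λ D w y →
      ((:- (w :* y)) :* con (+ 1) :+ (:- D) :* con (+ 0)) :* D
        :+ ((:- (w :* y)) :* con (+ 0) :+ (:- D) :* (:- con (+ 1))) :* (:- (w :* y))
      := ((con (+ 1) :+ con (+ 1)) :* D :* w) :* (con (+ 0) :* con (+ 0) :+ (:- con (+ 1)) :* y))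
      refl D ωλ ξ′)
    (trans XJX₂₂ (zeros (- D) JY₂₂))
    where
    t : Carrier
    t = 2# ⊛ D ⊛ ωλ

    zeros : ∀ d {y} → y ≈ 0# → d ⊛ (D + ωλ ⊛ ωλ) ≈ t ⊛ y
    zeros d y≈0 = trans (trans (*-congˡ D+ω²≈0) (zeroʳ d)) (sym (trans (*-congˡ y≈0) (zeroʳ t)))

  D+ωλ²≈ : D + ωλ ⊛ ωλ ≈ (ωκ ⊛ ωκ + 2# ⊛ (ωλ ⊛ ωλ)) - 4#
  D+ωλ²≈ = solve 2 (λ u w →
    let 2′ = con (+ 1) :+ con (+ 1) ; 4′ = con (+ 1) :+ con (+ 1) :+ con (+ 1) :+ con (+ 1) in
    (u :* u :+ w :* w :- 4′) :+ w :* w := (u :* u :+ 2′ :* (w :* w)) :- 4′) refl ωκ ωλ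

  möbiusRegular⇔ : MöbiusRegular regularMap ⇔ (2 ∣ k × ωκ ⊛ ωκ + 2# ⊛ (ωλ ⊛ ωλ) ≈ 4#)
  möbiusRegular⇔ = mk⇔ to from
    where
    R : G.Carrier
    R = gY G.∙ gZ

    R^k/2∼J : 2 ∣ k → matrix (pow G.monoid R (k / 2)) ∼ J
    -- Möbius regularity has the exponent `k / 2`; the quotient `m` witnessing `2 ∣ k` equals it.
    R^k/2∼J (divides m k≡m*2) = ≡.subst (λ n → matrix (pow G.monoid R n) ∼ J)
      (≡.sym (≡.trans (≡.cong (_/ 2) k≡m*2) (m*n/n≡m m 2))) (R^m∼J m k≡m*2)

    module _ (2∣k : 2 ∣ k) where
      XRX∼ : matX · matrix (pow G.monoid R (k / 2)) · matX ∼ X₀ · J · X₀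
      XRX∼ = ·-cong (·-cong matX∼X₀ (R^k/2∼J 2∣k)) matX∼X₀

      RY∼ : matrix (pow G.monoid R (k / 2)) · matY ∼ J · Y₀
      RY∼ = ·-cong (R^k/2∼J 2∣k) matY∼Y₀

    to : MöbiusRegular regularMap → 2 ∣ k × ωκ ⊛ ωκ + 2# ⊛ (ωλ ⊛ ωλ) ≈ 4#
    -- Equality in `G` is `∼` of the underlying matrices, so `XRX≈RY` composes directly with the
    -- changes of representative.
    to (2∣k , XRX≈RY) = 2∣k , -≈0⇒≈ (trans (sym D+ωλ²≈)
      (XJX∼JY⇒ (∼-trans (∼-sym (XRX∼ 2∣k)) (∼-trans XRX≈RY (RY∼ 2∣k)))))

    from : 2 ∣ k × ωκ ⊛ ωκ + 2# ⊛ (ωλ ⊛ ωλ) ≈ 4# → MöbiusRegular regularMap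
    -- The evenness of `k` is used twice: to identify the power of `R` with `J`, and to get `2≉0`,
    -- which makes the scalar nonzero.
    from (2∣k@(divides m k≡m*2) , ω≈4) = 2∣k , ∼-trans (XRX∼ 2∣k) (∼-trans
      (⇒XJX∼JY (2≉0 m k≡m*2) (trans D+ωλ²≈ (≈⇒-≈0 ω≈4))) (∼-sym (RY∼ 2∣k)))

proposition4p4 : ∀ {c ℓ} (p e k l : ℕ) .{{_ : NonZero k}} .{{_ : NonZero l}} →
    Prime p → p ≢ 2 → 1 ≤ e →
    (3≤k : 3 ≤ k) (3≤l : 3 ≤ l) → Coprime k p → Coprime l p → Hyperbolic k l →
    (𝔽p 𝔽q 𝔽q² K : Field c ℓ) →
    IsGF p 𝔽p → IsGF (p ^ e) 𝔽q → IsGF ((p ^ e) ^ 2) 𝔽q² →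
    (ιp : Embedding 𝔽p K) (ιq : Embedding 𝔽q K) (ιq² : Embedding 𝔽q² K) →
    IsAlgebraicClosure ιp →
    let module K = Field K in
    (ξκ ξλ : K.Carrier) →
    (primκ : IsPrimitiveRoot K (2 * k) ξκ) (primλ : IsPrimitiveRoot K (2 * l) ξλ) →
    (InImage ιq ξκ ⊎ InImage ιq² ξκ) →
    (InImage ιq ξλ ⊎ InImage ιq² ξλ) →
    let open Parameters K ξκ ξλ in
    (D≉0 : D K.≉ K.0#) →
    (√-D : K.Carrier) (√-D²≈-D : √-D K.* √-D K.≈ K.- D) →
    let map = TripleMap.regularMap K 3≤k 3≤l primκ primλ D≉0 √-D²≈-D in
    (RegularMap.group map ≅ PSL₂ 𝔽q ⊎ RegularMap.group map ≅ PGL₂ 𝔽q) →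
    MöbiusRegular map ⇔ (2 ∣ k × ωκ K.* ωκ K.+ 2# K.* (ωλ K.* ωλ) K.≈ 4#)
proposition4p4 _ _ _ _ _ _ _ 3≤k 3≤l _ _ _ _ _ _ K _ _ _ _ _ _ _ _ _ primκ primλ _ _ D≉0 _ √-D²≈-D _ =
  TripleMapProperties.möbiusRegular⇔ K 3≤k 3≤l primκ primλ D≉0 √-D²≈-D
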